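{- Let $\mathcal{F}$ be an $n$-periodic infinite frieze with quiddity sequence $q_{\mathcal{F}}=(a_1,a_2,\dots,a_n)$ such that $a_k=1$ for some $k\in\{1,2,\dots,n\}$. Then the $(n-1)$-tuple $$\check q_{\mathcal{F}}^{\,n}=\begin{cases}(a_{k+1}-2)&\text{if }n=2,\\ (a_1,\dots,a_{k-2},a_{k-1}-1,a_{k+1}-1,a_{k+2},\dots,a_n)&\text{otherwise},\end{cases}$$ where indices are reduced modulo $n$, is the quiddity sequence of an infinite frieze of period $n-1$.
   Context: An infinite frieze is an array $(m_{ij})_{i,j\in\mathbb{Z},\,j-i\ge -2}$ of integers with $m_{i,i-2}=0$ and $m_{i,i-1}=1$ for all $i\in\mathbb{Z}$, $m_{ij}>0$ for all $j\ge i$, and $m_{ij}m_{i+1,j+1}-m_{i+1,j}m_{i,j+1}=1$ for all $j-i\ge -1$. For an integer $n\ge1$ it is $n$-periodic (of period $n$; $n$ need not be the minimal period) if $m_{ij}=m_{i+n,j+n}$ for all $i\le j$. The quiddity sequence of an $n$-periodic infinite frieze is the $n$-tuple $(a_1,\dots,a_n)$, determined up to cyclic equivalence, with $a_i=m_{ii}$. (An entry $1$ in the quiddity sequence can occur only if $n\ge 2$.) The tuple in the case $n\ge3$ is obtained by removing the entry $a_k$ and decreasing its two cyclic neighbors by $1$; e.g. for $k=1$ it is $(a_2-1,a_3,\dots,a_{n-1},a_n-1)$. -}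

module Defs where

open import Data.Fin.Base using (Fin; toℕ)
open import Data.Integer.Base using (ℤ; +_; 0ℤ; 1ℤ; _+_; _-_; _*_; -_; _≤_; _<_)
open import Data.Nat.Base using (ℕ; zero; suc; NonZero)
import Data.Nat.Base as ℕ
open import Data.Nat.DivMod using (_mod_)
open import Data.Product.Base using (∃-syntax)
open import Data.Vec.Functional using (Vector; removeAt; updateAt)
open import Relation.Binary.PropositionalEquality.Core using (_≡_)

-- The array (m i j) is indexed by the pairs with j - i ≥ -2.  It is
-- represented by a total function; its values at j - i < -2 are arbitrary and
-- no condition refers to them.
record InfiniteFrieze : Set where
  field
    m        : ℤ → ℤ → ℤ
    zeros    : ∀ i → m i (i - + 2) ≡ 0ℤ
    ones     : ∀ i → m i (i - 1ℤ) ≡ 1ℤ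
    positive : ∀ i j → i ≤ j → 0ℤ < m i j
    diamond  : ∀ i j → - 1ℤ ≤ j - i →
               m i j * m (i + 1ℤ) (j + 1ℤ) - m (i + 1ℤ) j * m i (j + 1ℤ) ≡ 1ℤ

-- n is a period, not necessarily the minimal one.
record IsPeriodic (n : ℕ) (F : InfiniteFrieze) : Set where
  open InfiniteFrieze F
  field
    nonZero  : NonZero n
    periodic : ∀ i j → i ≤ j → m i j ≡ m (i + + n) (j + + n)

-- For an n-periodic frieze the quiddity sequence is determined only up to
-- cyclic equivalence: it may be read off the diagonal m i i starting at any
-- index s, and changing s rotates the tuple.
IsQuiddity : ∀ {n} → InfiniteFrieze → Vector ℤ n → Set
IsQuiddity {n} F q =
  ∃[ s ] ∀ (i : Fin n) → q i ≡ m (s + + toℕ i) (s + + toℕ i)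
  where open InfiniteFrieze F

next prev : ∀ {p} → Fin (suc p) → Fin (suc p)
next {p} k = suc (toℕ k) mod suc p
prev {p} k = (toℕ k ℕ.+ p) mod suc p

-- The passage from an n-tuple to an (n-1)-tuple, with n = suc p.  For n = 1
-- the only 0-tuple is returned; it is never the quiddity sequence of a
-- periodic frieze, since periods are nonzero.
reduce : ∀ {p} → Fin (suc p) → Vector ℤ (suc p) → Vector ℤ p
reduce {zero}        k a = λ ()
reduce {suc zero}    k a = λ _ → a (next k) - + 2
reduce {suc (suc p)} k a =
  removeAt (updateAt (updateAt a (prev k) (_- 1ℤ)) (next k) (_- 1ℤ)) k

{-# OPTIONS --safe #-}
module Submission where

-- Read the entry m i j as the label of the arc from i - 1 to j + 1, so that the
-- frieze rule is a Ptolemy relation on the vertices ℤ and a quiddity entry 1 is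
-- an ear cutting off one vertex.  Deleting all ears in the residue class of k mod n
-- and keeping the labels of the remaining arcs gives the new frieze: across an
-- ear the three-term recurrences turn the Ptolemy relation for the vertex into
-- the one for the arc that cuts it off, and each neighbour of a deleted vertex
-- loses 1 from its quiddity entry.

open import Defs
open import Data.Bool.Base using (if_then_else_)
open import Data.Empty using (⊥; ⊥-elim)
open import Data.Fin.Base using (Fin; zero; suc; toℕ; punchIn)
open import Data.Fin.Properties using (toℕ-injective; toℕ-fromℕ<; toℕ<n; toℕ≤pred[n])
open import Data.Integer.Base
  using (ℤ; +_; -[1+_]; 0ℤ; 1ℤ; _+_; _-_; _*_; -_; _≤_; _<_; ∣_∣; _/ℕ_; _%ℕ_; +<+; >-nonZero)
open import Data.Integer.DivMod using (n%ℕd<d; a≡a%ℕn+[a/ℕn]*n)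
open import Data.Integer.Properties
open import Data.Integer.Tactic.RingSolver using (solve-∀)
open import Algebra.Properties.AbelianGroup +-0-abelianGroup using (∙-cancelʳ)
open import Data.Nat.Base as ℕ using (ℕ; zero; suc; NonZero; z≤n; s≤s)
open import Data.Nat.DivMod using (_%_; _mod_; [m+n]%n≡m%n; m%n%n≡m%n; m<n⇒m%n≡m; %-distribˡ-+)
import Data.Nat.Properties as ℕ
import Data.Nat.Tactic.RingSolver as ℕ-Solver
open import Data.Product.Base using (∃-syntax; _,_; _×_; proj₁; proj₂)
open import Data.Sum.Base using (_⊎_; inj₁; inj₂)
open import Data.Vec.Functional using (Vector; updateAt)
open import Data.Vec.Functional.Properties using (updateAt-updates; updateAt-minimal)
open import Function.Base using (_∘_)
open import Relation.Binary.PropositionalEquality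
  using (_≡_; refl; sym; trans; cong; cong₂; subst; subst₂; module ≡-Reasoning)
open import Relation.Nullary using (Dec; yes; no; does)

-- Shifts and induction on the integers.

private
  i+1-1≡i : ∀ i → i + 1ℤ - 1ℤ ≡ i
  i+1-1≡i = solve-∀

  i-1+1≡i : ∀ i → i - 1ℤ + 1ℤ ≡ i
  i-1+1≡i = solve-∀

  i-1+1≡i+1-1 : ∀ i → i - 1ℤ + 1ℤ ≡ i + 1ℤ - 1ℤ
  i-1+1≡i+1-1 = solve-∀

≤⇒≡+ : ∀ {i j} → i ≤ j → ∃[ l ] j ≡ i + + l
≤⇒≡+ {i} {j} i≤j = ∣ j - i ∣ , (begin
  j                ≡⟨ lemma i j ⟩
  i + (j - i)      ≡⟨ cong (λ x → i + x) (0≤i⇒+∣i∣≡i (i≤j⇒0≤j-i i≤j)) ⟨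
  i + + ∣ j - i ∣  ∎)
  where
  open ≡-Reasoning
  lemma : ∀ i j → j ≡ i + (j - i)
  lemma = solve-∀

i+[1+l]≡i+l+1 : ∀ i l → i + + suc l ≡ i + + l + 1ℤ
i+[1+l]≡i+l+1 i l = lemma i (+ l)
  where
  lemma : ∀ i x → i + (1ℤ + x) ≡ i + x + 1ℤ
  lemma = solve-∀

i≤i+n : ∀ i n → i ≤ i + + n
i≤i+n i n = i≤i+j i (+ n)

≤-induction : ∀ {i} (P : ℤ → Set) → P i → (∀ {j} → i ≤ j → P j → P (j + 1ℤ)) →
              ∀ {j} → i ≤ j → P j
≤-induction {i} P base step i≤j with l , refl ← ≤⇒≡+ i≤j = go l
  where
  go : ∀ l → P (i + + l)
  go zero    = subst P (sym (+-identityʳ i)) base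
  go (suc l) = subst P (sym (i+[1+l]≡i+l+1 i l)) (step (i≤i+n i l) (go l))

-- Friezes as labellings of arcs.

-- d u v is the entry m (u + 1) (v - 1), seen as the label of the arc from u
-- to v; the frieze rule then becomes the Ptolemy relation.
record ArcFrieze : Set where
  field
    d        : ℤ → ℤ → ℤ
    loop     : ∀ u → d u u ≡ 0ℤ
    side     : ∀ u → d u (u + 1ℤ) ≡ 1ℤ
    positive : ∀ u v → u + 1ℤ ≤ v → 0ℤ < d u v
    ptolemy  : ∀ u v → u + 1ℤ ≤ v →
               d u v * d (u + 1ℤ) (v + 1ℤ) - d (u + 1ℤ) v * d u (v + 1ℤ) ≡ 1ℤ

toArcs : InfiniteFrieze → ArcFrieze
toArcs F = record
  { d        = d
  ; loop     = λ u → trans (cong (m (u + 1ℤ)) (lemma u)) (zeros (u + 1ℤ))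
  ; side     = side
  ; positive = positive′
  ; ptolemy  = λ u v u<v →
      trans (cong (λ x → d u v * m (u + 1ℤ + 1ℤ) x - d (u + 1ℤ) v * m (u + 1ℤ) x)
                  (sym (i-1+1≡i+1-1 v)))
            (diamond (u + 1ℤ) (v - 1ℤ) (bound u v u<v))
  }
  where
  open InfiniteFrieze F
  d : ℤ → ℤ → ℤ
  d u v = m (u + 1ℤ) (v - 1ℤ)

  lemma : ∀ u → u - 1ℤ ≡ u + 1ℤ - + 2
  lemma = solve-∀

  side : ∀ u → d u (u + 1ℤ) ≡ 1ℤ
  side u = ones (u + 1ℤ)

  positive′ : ∀ u v → u + 1ℤ ≤ v → 0ℤ < d u v
  positive′ u v u<v with ≤⇒≡+ u<v
  -- A side is an entry with `j = i - 1`, outside the range of the positivity axiom; it is 1 by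
  -- `ones`.
  ... | zero  , refl = subst (0ℤ <_)
    (sym (trans (cong (d u) (+-identityʳ (u + 1ℤ))) (side u))) (+<+ (s≤s z≤n))
  ... | suc l , refl = positive (u + 1ℤ) (u + 1ℤ + + suc l - 1ℤ)
    (subst (u + 1ℤ ≤_) (lemma′ (u + 1ℤ) (+ l)) (i≤i+n (u + 1ℤ) l))
    where
    lemma′ : ∀ i l → i + l ≡ i + (1ℤ + l) - 1ℤ
    lemma′ = solve-∀

  bound : ∀ u v → u + 1ℤ ≤ v → - 1ℤ ≤ v - 1ℤ - (u + 1ℤ)
  bound u v u<v = subst (- 1ℤ ≤_) (lemma′ u v) (+-monoʳ-≤ (- 1ℤ) (i≤j⇒0≤j-i u<v))
    where
    lemma′ : ∀ u v → - 1ℤ + (v - (u + 1ℤ)) ≡ v - 1ℤ - (u + 1ℤ)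
    lemma′ = solve-∀

fromArcs : ArcFrieze → InfiniteFrieze
fromArcs A = record
  { m        = λ i j → d (i - 1ℤ) (j + 1ℤ)
  ; zeros    = λ i → trans (cong (d (i - 1ℤ)) (zeros-index i)) (loop (i - 1ℤ))
  ; ones     = λ i → side (i - 1ℤ)
  ; positive = λ i j i≤j → positive (i - 1ℤ) (j + 1ℤ)
      (≤-trans (≤-reflexive (i-1+1≡i i)) (≤-trans i≤j (i≤i+n j 1)))
  ; diamond  = λ i j -1≤j-i →
      trans (cong (λ x → d (i - 1ℤ) (j + 1ℤ) * d x (j + 1ℤ + 1ℤ)
                          - d x (j + 1ℤ) * d (i - 1ℤ) (j + 1ℤ + 1ℤ))
                  (sym (i-1+1≡i+1-1 i)))
            (ptolemy (i - 1ℤ) (j + 1ℤ) (subst₂ _≤_ (lower i) (upper i j) (+-monoʳ-≤ (i + 1ℤ) -1≤j-i)))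
  }
  where
  open ArcFrieze A
  zeros-index : ∀ i → i - + 2 + 1ℤ ≡ i - 1ℤ
  zeros-index = solve-∀

  lower : ∀ i → i + 1ℤ + - 1ℤ ≡ i - 1ℤ + 1ℤ
  lower = solve-∀

  upper : ∀ i j → i + 1ℤ + (j - i) ≡ j + 1ℤ
  upper = solve-∀

-- Ears and the Ptolemy relation across them.

module Ears (A : ArcFrieze) where
  open ArcFrieze A
  open ≡-Reasoning

  -- Indexed by the left end of the arc; the vertex cut off is `w + 1ℤ`.
  Ear : ℤ → Set
  Ear w = d w (w + 1ℤ + 1ℤ) ≡ 1ℤ

  -- Subtracting the two determinant equations gives `y₀ * (x₋ + x₊) ≡ (y₋ + y₊) * x₀`, and the
  -- positive factor `y₀` cancels. The common value `e` is 1 along columns and -1 along rows.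
  transfer : ∀ x₋ x₀ x₊ y₋ y₀ y₊ {e} → 0ℤ < y₀ →
             x₋ * y₀ - y₋ * x₀ ≡ e → x₀ * y₊ - y₀ * x₊ ≡ e →
             y₀ ≡ y₋ + y₊ → x₀ ≡ x₋ + x₊
  transfer x₋ x₀ x₊ y₋ y₀ y₊ {e} 0<y₀ p₋ p₊ y₀≡ =
    *-cancelˡ-≡ y₀ x₀ (x₋ + x₊) {{>-nonZero 0<y₀}} (sym (begin
      y₀ * (x₋ + x₊)
        ≡⟨ regroup x₋ x₀ x₊ y₋ y₀ y₊ ⟩
      (x₋ * y₀ - y₋ * x₀) - (x₀ * y₊ - y₀ * x₊) + (y₋ + y₊) * x₀
        ≡⟨ cong₂ _+_ (cong₂ _-_ p₋ p₊) (cong (_* x₀) (sym y₀≡)) ⟩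
      e - e + y₀ * x₀
        ≡⟨ cancel e (y₀ * x₀) ⟩
      y₀ * x₀ ∎))
    where
    regroup : ∀ x₋ x₀ x₊ y₋ y₀ y₊ → y₀ * (x₋ + x₊) ≡
              (x₋ * y₀ - y₋ * x₀) - (x₀ * y₊ - y₀ * x₊) + (y₋ + y₊) * x₀
    regroup = solve-∀
    cancel : ∀ e z → e - e + z ≡ z
    cancel = solve-∀

  -- Induction as `u` moves left from `w`. At `u = w` the equation reads 1 = 0 + 1; each further
  -- step is `transfer` applied to the Ptolemy relations in two neighbouring rows.
  ear-column : ∀ {u w} → Ear w → u ≤ w → d u (w + 1ℤ) ≡ d u w + d u (w + 1ℤ + 1ℤ)
  ear-column {u} {w} ear u≤w with l , w≡ ← ≤⇒≡+ u≤w = go u l w≡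
    where
    go : ∀ u l → w ≡ u + + l → d u (w + 1ℤ) ≡ d u w + d u (w + 1ℤ + 1ℤ)
    go u zero    w≡ rewrite trans (sym (+-identityʳ u)) (sym w≡) =
      trans (side w) (sym (cong₂ _+_ (loop w) ear))
    go u (suc l) w≡ = transfer
      (d u w)        (d u (w + 1ℤ))        (d u (w + 1ℤ + 1ℤ))
      (d (u + 1ℤ) w) (d (u + 1ℤ) (w + 1ℤ)) (d (u + 1ℤ) (w + 1ℤ + 1ℤ))
      (positive (u + 1ℤ) (w + 1ℤ) (+-monoˡ-≤ 1ℤ u+1≤w))
      (ptolemy u w u+1≤w) (ptolemy u (w + 1ℤ) (≤-trans u+1≤w (i≤i+n w 1)))
      (go (u + 1ℤ) l w≡′)
      where
      w≡′ : w ≡ u + 1ℤ + + l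
      w≡′ = trans w≡ (sym (+-assoc u 1ℤ (+ l)))
      u+1≤w : u + 1ℤ ≤ w
      u+1≤w = subst (u + 1ℤ ≤_) (sym w≡′) (i≤i+n (u + 1ℤ) l)

  -- The mirror image of `ear-column`, with `v` moving right from `w + 2`; exchanging rows and
  -- columns turns the determinants into -1.
  ear-row : ∀ {w v} → Ear w → w + 1ℤ + 1ℤ ≤ v → d (w + 1ℤ) v ≡ d w v + d (w + 1ℤ + 1ℤ) v
  ear-row {w} ear = ≤-induction (λ v → d (w + 1ℤ) v ≡ d w v + d (w + 1ℤ + 1ℤ) v)
    (trans (side (w + 1ℤ)) (sym (cong₂ _+_ ear (loop (w + 1ℤ + 1ℤ)))))
    (λ {v} w+2≤v ih → transfer
      (d w (v + 1ℤ)) (d (w + 1ℤ) (v + 1ℤ)) (d (w + 1ℤ + 1ℤ) (v + 1ℤ))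
      (d w v)        (d (w + 1ℤ) v)        (d (w + 1ℤ + 1ℤ) v)
      (positive (w + 1ℤ) v w+2≤v)
      (flip-sign w v (ptolemy w v (≤-trans (i≤i+n (w + 1ℤ) 1) w+2≤v)))
      (flip-sign (w + 1ℤ) v (ptolemy (w + 1ℤ) v w+2≤v)) ih)
    where
    flip-sign : ∀ u v →
                d u v * d (u + 1ℤ) (v + 1ℤ) - d (u + 1ℤ) v * d u (v + 1ℤ) ≡ 1ℤ →
                d u (v + 1ℤ) * d (u + 1ℤ) v - d u v * d (u + 1ℤ) (v + 1ℤ) ≡ - 1ℤ
    flip-sign u v eq = trans
      (lemma (d u v) (d (u + 1ℤ) (v + 1ℤ)) (d (u + 1ℤ) v) (d u (v + 1ℤ)))
      (cong -_ eq)
      where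
      lemma : ∀ a b c e → e * c - a * b ≡ - (a * b - c * e)
      lemma = solve-∀

  -- The possible sides of the new frieze: an old side, or the arc that cuts off an ear. Both carry
  -- the label 1.
  data Edge (u : ℤ) : ℤ → Set where
    short : Edge u (u + 1ℤ)
    long  : Ear u → Edge u (u + 1ℤ + 1ℤ)

  edge-< : ∀ {u u′} → Edge u u′ → u + 1ℤ ≤ u′
  edge-< {u} short    = ≤-refl
  edge-< {u} (long _) = i≤i+n (u + 1ℤ) 1

  edge-1 : ∀ {u u′} → Edge u u′ → d u u′ ≡ 1ℤ
  edge-1 {u} short  = side u
  edge-1 (long ear) = ear

  -- Over a long edge, column `v + 1` is the sum of columns `v` and `v + 2`, so replacing column `v`
  -- by it leaves the determinant unchanged.
  short-ptolemy : ∀ {u v v′} → Edge v v′ → u + 1ℤ ≤ v →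
                  d u v * d (u + 1ℤ) v′ - d (u + 1ℤ) v * d u v′ ≡ 1ℤ
  short-ptolemy {u} {v} short      u<v = ptolemy u v u<v
  short-ptolemy {u} {v} (long ear) u<v = begin
    a * c′ - a′ * c
      ≡⟨ lemma a c a′ c′ ⟩
    (a + c) * c′ - (a′ + c′) * c
      ≡⟨ cong₂ (λ x y → x * c′ - y * c)
               (ear-column ear (≤-trans (i≤i+n u 1) u<v)) (ear-column ear u<v) ⟨
    d u (v + 1ℤ) * c′ - d (u + 1ℤ) (v + 1ℤ) * c
      ≡⟨ ptolemy u (v + 1ℤ) (≤-trans u<v (i≤i+n v 1)) ⟩
    1ℤ ∎
    where
    a  = d u v
    c  = d u (v + 1ℤ + 1ℤ)
    a′ = d (u + 1ℤ) v
    c′ = d (u + 1ℤ) (v + 1ℤ + 1ℤ)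
    lemma : ∀ a c a′ c′ → a * c′ - a′ * c ≡ (a + c) * c′ - (a′ + c′) * c
    lemma = solve-∀

  -- The same operation on rows: row `u + 1` is the sum of rows `u` and `u + 2`.
  edge-ptolemy : ∀ {u u′ v v′} → Edge u u′ → Edge v v′ → u′ ≤ v →
                 d u v * d u′ v′ - d u′ v * d u v′ ≡ 1ℤ
  edge-ptolemy                  short      e u<v   = short-ptolemy e u<v
  edge-ptolemy {u} {_} {v} {v′} (long ear) e u+2≤v = begin
    a * c′ - c * a′
      ≡⟨ lemma a c a′ c′ ⟩
    (a + c) * c′ - c * (a′ + c′)
      ≡⟨ cong₂ (λ x y → x * c′ - c * y) (ear-row ear u+2≤v)
               (ear-row ear (≤-trans u+2≤v (≤-trans (i≤i+n v 1) (edge-< e)))) ⟨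
    d (u + 1ℤ) v * c′ - c * d (u + 1ℤ) v′
      ≡⟨ short-ptolemy e u+2≤v ⟩
    1ℤ ∎
    where
    a  = d u v
    c  = d (u + 1ℤ + 1ℤ) v
    a′ = d u v′
    c′ = d (u + 1ℤ + 1ℤ) v′
    lemma : ∀ a c a′ c′ → a * c′ - c * a′ ≡ (a + c) * c′ - c * (a′ + c′)
    lemma = solve-∀

  -- `ear-row` splits `d (u + 1ℤ) v` into two summands, one of which is an edge label and so 1. This
  -- is the loss of 1 at the right neighbour `u + 2` of the deleted vertex; `long-right` gives the
  -- loss at the left neighbour.
  long-left : ∀ {u v} → Ear u → Edge (u + 1ℤ + 1ℤ) v → d u v ≡ d (u + 1ℤ) v - 1ℤ
  long-left {u} {v} ear e = begin
    d u v                                            ≡⟨ lemma (d u v) _ ⟩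
    d u v + d (u + 1ℤ + 1ℤ) v - d (u + 1ℤ + 1ℤ) v    ≡⟨ cong₂ _-_ (sym row) (edge-1 e) ⟩
    d (u + 1ℤ) v - 1ℤ                                ∎
    where
    row = ear-row ear (≤-trans (i≤i+n _ 1) (edge-< e))
    lemma : ∀ a c → a ≡ a + c - c
    lemma = solve-∀

  long-right : ∀ {u v} → Edge u v → Ear v → d u (v + 1ℤ + 1ℤ) ≡ d u (v + 1ℤ) - 1ℤ
  long-right {u} {v} e ear = begin
    d u (v + 1ℤ + 1ℤ)                    ≡⟨ lemma (d u v) _ ⟩
    d u v + d u (v + 1ℤ + 1ℤ) - d u v    ≡⟨ cong₂ _-_ (sym column) (edge-1 e) ⟩
    d u (v + 1ℤ) - 1ℤ                    ∎
    where
    column = ear-column ear (≤-trans (i≤i+n u 1) (edge-< e))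
    lemma : ∀ a c → c ≡ a + c - a
    lemma = solve-∀

  -- Deleting the second ear would lower the label 1 of the first to 0, against positivity. This
  -- excludes period 1.
  no-consecutive-ears : ∀ {w} → Ear w → Ear (w + 1ℤ) → ⊥
  no-consecutive-ears {w} ear ear′ = <-irrefl (sym (begin
    d w (w + 1ℤ + 1ℤ + 1ℤ)      ≡⟨ long-right short ear′ ⟩
    d w (w + 1ℤ + 1ℤ) - 1ℤ      ≡⟨ cong (_- 1ℤ) ear ⟩
    0ℤ                          ∎))
    (positive w (w + 1ℤ + 1ℤ + 1ℤ) (≤-trans (i≤i+n (w + 1ℤ) 1) (i≤i+n (w + 1ℤ + 1ℤ) 1)))

  module Restriction (ψ : ℤ → ℤ) (step : ∀ x → Edge (ψ x) (ψ (x + 1ℤ))) where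

    ψ-mono : ∀ {x y} → x ≤ y → ψ x ≤ ψ y
    ψ-mono {x} = ≤-induction (λ y → ψ x ≤ ψ y) ≤-refl
      (λ {y} _ ih → ≤-trans ih (≤-trans (i≤i+n (ψ y) 1) (edge-< (step y))))

    -- By `step` the arcs between consecutive values of `ψ` are edges; they become the new sides,
    -- and `edge-ptolemy` becomes the new frieze rule.
    restrict : ArcFrieze
    restrict = record
      { d        = λ x y → d (ψ x) (ψ y)
      ; loop     = λ x → loop (ψ x)
      ; side     = λ x → edge-1 (step x)
      ; positive = λ x y x<y → positive (ψ x) (ψ y) (≤-trans (edge-< (step x)) (ψ-mono x<y))
      ; ptolemy  = λ x y x<y → edge-ptolemy (step x) (step y) (ψ-mono x<y)
      }

-- The amount subtracted from a quiddity entry on account of one possible deleted neighbour.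
indicator : {P : Set} → Dec P → ℤ
indicator P? = if does P? then 1ℤ else 0ℤ

-- Uniqueness of division with remainder.

module _ (p : ℕ) where
  open ≤-Reasoning

  quotient-≤ : ∀ {r r′ t t′} → r′ ℕ.< p → + r + t * + p ≡ + r′ + t′ * + p → t ≤ t′
  quotient-≤ {r} {r′} {t} {t′} r′<p eq =
    subst (t ≤_) (pred-suc t′) (i<j⇒i≤pred[j] (*-cancelʳ-<-nonNeg {t} {1ℤ + t′} (+ p) (begin-strict
      t * + p          ≤⟨ i≤j+i (t * + p) (+ r) ⟩
      + r + t * + p    ≡⟨ eq ⟩
      + r′ + t′ * + p  <⟨ +-monoˡ-< (t′ * + p) (+<+ r′<p) ⟩
      + p + t′ * + p   ≡⟨ suc-* t′ (+ p) ⟨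
      (1ℤ + t′) * + p  ∎)))

  divMod-unique : ∀ {r r′ t t′} → r ℕ.< p → r′ ℕ.< p →
                  + r + t * + p ≡ + r′ + t′ * + p → r ≡ r′ × t ≡ t′
  divMod-unique {r} {r′} {t} {t′} r<p r′<p eq
    with refl ← ≤-antisym (quotient-≤ {r} {r′} {t} {t′} r′<p eq)
                          (quotient-≤ {r′} {r} {t′} {t} r<p (sym eq)) =
    +-injective (∙-cancelʳ (t * + p) (+ r) (+ r′) eq) , refl

-- Enumeration of the kept vertices.

-- ψ enumerates increasingly the integers not congruent to c modulo p + 1.
module Skip (c : ℤ) (p : ℕ) {{_ : NonZero p}} where

  ψ : ℤ → ℤ
  ψ x = c + 1ℤ + + (x %ℕ p) + (x /ℕ p) * + suc p

  -- Quotient and remainder are unique, so any decomposition of `x` computes `ψ x`. Block `t`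
  -- consists of the `p` kept vertices right after the deleted vertex `c + t * + suc p`.
  ψ-value : ∀ {x r} t → r ℕ.< p → x ≡ + r + t * + p → ψ x ≡ c + 1ℤ + + r + t * + suc p
  ψ-value {x} {r} t r<p x≡
    with r≡ , t≡ ← divMod-unique p {t = x /ℕ p} {t} (n%ℕd<d x p) r<p
                     (trans (sym (a≡a%ℕn+[a/ℕn]*n x p)) x≡) =
    cong₂ (λ a b → c + 1ℤ + + a + b * + suc p) r≡ t≡

  ψ-periodic : ∀ x → ψ (x + + p) ≡ ψ x + + suc p
  ψ-periodic x = trans
    (ψ-value (1ℤ + x /ℕ p) (n%ℕd<d x p)
      (trans (cong (_+ + p) (a≡a%ℕn+[a/ℕn]*n x p)) (shift (+ (x %ℕ p)) (x /ℕ p) (+ p))))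
    (shift′ (c + 1ℤ + + (x %ℕ p)) (x /ℕ p) (+ suc p))
    where
    shift : ∀ r t p → r + t * p + p ≡ r + (1ℤ + t) * p
    shift = solve-∀
    shift′ : ∀ r t p → r + (1ℤ + t) * p ≡ r + t * p + p
    shift′ = solve-∀

  ψ-step-short : ∀ {x r} t → suc r ℕ.< p → x ≡ + r + t * + p → ψ (x + 1ℤ) ≡ ψ x + 1ℤ
  ψ-step-short {x} {r} t 1+r<p x≡ = trans
    (ψ-value t 1+r<p (trans (cong (_+ 1ℤ) x≡) (lemma (+ r) (t * + p))))
    (trans (lemma′ c (+ r) (t * + suc p))
           (cong (_+ 1ℤ) (sym (ψ-value t (ℕ.<-trans (ℕ.n<1+n r) 1+r<p) x≡))))
    where
    lemma : ∀ r t → r + t + 1ℤ ≡ 1ℤ + r + t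
    lemma = solve-∀
    lemma′ : ∀ c r t → c + 1ℤ + (1ℤ + r) + t ≡ c + 1ℤ + r + t + 1ℤ
    lemma′ = solve-∀

  -- From the last place of block `t` to the first of the next. The first component identifies the
  -- vertex jumped over as a deleted one, which is where an ear is available.
  ψ-step-long : ∀ {x r} t → suc r ≡ p → x ≡ + r + t * + p →
                ψ x + 1ℤ ≡ c + (1ℤ + t) * + suc p × ψ (x + 1ℤ) ≡ ψ x + 1ℤ + 1ℤ
  ψ-step-long {x} {r} t refl x≡ = skipped , trans
    (ψ-value (1ℤ + t) (s≤s z≤n) (trans (cong (_+ 1ℤ) x≡) (lemma (+ r) t)))
    (trans (lemma″ c ((1ℤ + t) * + suc p)) (cong (_+ 1ℤ) (sym skipped)))
    where
    lemma : ∀ r t → r + t * (1ℤ + r) + 1ℤ ≡ 0ℤ + (1ℤ + t) * (1ℤ + r)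
    lemma = solve-∀
    lemma′ : ∀ c r t → c + 1ℤ + r + t * (1ℤ + (1ℤ + r)) + 1ℤ ≡ c + (1ℤ + t) * (1ℤ + (1ℤ + r))
    lemma′ = solve-∀
    lemma″ : ∀ c n → c + 1ℤ + 0ℤ + n ≡ c + n + 1ℤ
    lemma″ = solve-∀
    skipped : ψ x + 1ℤ ≡ c + (1ℤ + t) * + suc p
    skipped = trans (cong (_+ 1ℤ) (ψ-value t (ℕ.n<1+n r) x≡)) (lemma′ c (+ r) t)

  -- Cutting the ears and the effect on quiddity entries.

  module _ (A : ArcFrieze) where
    open ArcFrieze A
    open Ears A

    module Cut (ears : ∀ x t → x + 1ℤ ≡ c + t * + suc p → Ear x) where

      edge-at : ∀ {x r} t → r ℕ.< p → x ≡ + r + t * + p → Edge (ψ x) (ψ (x + 1ℤ))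
      edge-at {x} {r} t r<p x≡ with suc r ℕ.≟ p
      ... | no  1+r≢p = subst (Edge (ψ x)) (sym (ψ-step-short t (ℕ.≤∧≢⇒< r<p 1+r≢p) x≡)) short
      ... | yes 1+r≡p with skipped , next≡ ← ψ-step-long t 1+r≡p x≡ =
        subst (Edge (ψ x)) (sym next≡) (long (ears (ψ x) (1ℤ + t) skipped))

      step : ∀ x → Edge (ψ x) (ψ (x + 1ℤ))
      step x = edge-at (x /ℕ p) (n%ℕd<d x p) (a≡a%ℕn+[a/ℕn]*n x p)

      open Restriction ψ step public

      -- Only the last vertex of a block has a deleted vertex on its right. The decision is an
      -- argument so that it can be split on directly.
      right-shift : ∀ {x r} t → r ℕ.< p → x ≡ + r + t * + p → (last? : Dec (suc r ≡ p)) →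
                    ∀ {u} → Edge u (ψ x) →
                    d u (ψ (x + 1ℤ)) ≡ d u (ψ x + 1ℤ) - indicator last?
      right-shift {x} t r<p x≡ (no 1+r≢p) {u} e =
        trans (cong (d u) (ψ-step-short t (ℕ.≤∧≢⇒< r<p 1+r≢p) x≡)) (sym (+-identityʳ _))
      right-shift {x} t r<p x≡ (yes 1+r≡p) {u} e
        with skipped , next≡ ← ψ-step-long t 1+r≡p x≡ =
        trans (cong (d u) next≡) (long-right e (ears (ψ x) (1ℤ + t) skipped))

      left-shift : ∀ {x r} t → r ℕ.< p → x ≡ + r + t * + p → ∀ {v} → Edge (ψ x) v →
                   d (ψ (x - 1ℤ)) v ≡ d (ψ x - 1ℤ) v - indicator (r ℕ.≟ 0)
      left-shift {x} {suc r} t r<p x≡ {v} e = trans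
        (cong (λ y → d y v) (begin
          ψ (x - 1ℤ)              ≡⟨ i+1-1≡i (ψ (x - 1ℤ)) ⟨
          ψ (x - 1ℤ) + 1ℤ - 1ℤ    ≡⟨ cong (_- 1ℤ) (ψ-step-short t r<p x-1≡) ⟨
          ψ (x - 1ℤ + 1ℤ) - 1ℤ    ≡⟨ cong (λ y → ψ y - 1ℤ) (i-1+1≡i x) ⟩
          ψ x - 1ℤ                ∎))
        (sym (+-identityʳ _))
        where
        open ≡-Reasoning
        lemma : ∀ r t → 1ℤ + r + t - 1ℤ ≡ r + t
        lemma = solve-∀
        x-1≡ : x - 1ℤ ≡ + r + t * + p
        x-1≡ = trans (cong (_- 1ℤ) x≡) (lemma (+ r) (t * + p))
      left-shift {x} {zero} t r<p x≡ {v} e = trans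
        (long-left (ears (ψ (x - 1ℤ)) (1ℤ + (t - 1ℤ)) (proj₁ stepped))
                   (subst (λ y → Edge y v) ψx≡ e))
        (cong (λ y → d y v - 1ℤ) (trans (sym (i+1-1≡i _)) (cong (_- 1ℤ) (sym ψx≡))))
        where
        lemma : ∀ p t → 0ℤ + t * (1ℤ + p) - 1ℤ ≡ p + (t - 1ℤ) * (1ℤ + p)
        lemma = solve-∀
        -- The place before the first one of block `t` is the last one of block `t - 1`, with
        -- remainder `p - 1`.
        x-1≡ : x - 1ℤ ≡ + ℕ.pred p + (t - 1ℤ) * + p
        x-1≡ = subst (λ n → x - 1ℤ ≡ + ℕ.pred p + (t - 1ℤ) * + n) (ℕ.suc-pred p)
          (trans (cong (_- 1ℤ) (trans x≡ (cong (λ n → 0ℤ + t * + n) (sym (ℕ.suc-pred p)))))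
                 (lemma (+ ℕ.pred p) t))
        stepped = ψ-step-long (t - 1ℤ) (ℕ.suc-pred p) x-1≡
        ψx≡ : ψ x ≡ ψ (x - 1ℤ) + 1ℤ + 1ℤ
        ψx≡ = trans (cong ψ (sym (i-1+1≡i x))) (proj₂ stepped)

      -- The left end is moved first, against the new edge on the right; the right end is then moved
      -- against the old side on the left. For `p = 1` both indicators are 1 and the entry loses 2.
      quiddity-shift : ∀ {x r} t → r ℕ.< p → x ≡ + r + t * + p →
                       d (ψ (x - 1ℤ)) (ψ (x + 1ℤ)) ≡
                       d (ψ x - 1ℤ) (ψ x + 1ℤ) - indicator (suc r ℕ.≟ p) - indicator (r ℕ.≟ 0)
      quiddity-shift {x} {r} t r<p x≡ = trans
        (left-shift t r<p x≡ (step x))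
        (cong (_- indicator (r ℕ.≟ 0))
              (right-shift t r<p x≡ (suc r ℕ.≟ p) (subst (Edge (ψ x - 1ℤ)) (i-1+1≡i (ψ x)) short)))

-- Cyclic positions in the tuple and the entries of `reduce`.

rotate : ∀ {p} → Fin (suc p) → ℕ → Fin (suc p)
rotate {p} k a = (toℕ k ℕ.+ a) mod suc p

toℕ-rotate : ∀ {p} (k : Fin (suc p)) a → toℕ (rotate k a) ≡ (toℕ k ℕ.+ a) % suc p
toℕ-rotate k a = toℕ-fromℕ< _

-- Adding the complement `n - k` undoes the rotation modulo `n`, and `a`, `b` are already reduced.
rotate-injective : ∀ {p} (k : Fin (suc p)) {a b} → a ℕ.≤ p → b ℕ.≤ p →
                   rotate k a ≡ rotate k b → a ≡ b
rotate-injective {p} k {a} {b} a≤p b≤p eq =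
  trans (sym (unrotate a a≤p)) (trans (cong (λ x → (toℕ x ℕ.+ o) % n) eq) (unrotate b b≤p))
  where
  open ≡-Reasoning
  n o : ℕ
  n = suc p
  o = n ℕ.∸ toℕ k
  lemma : ∀ k a o → k ℕ.+ a ℕ.+ o ≡ a ℕ.+ (k ℕ.+ o)
  lemma = ℕ-Solver.solve-∀
  unrotate : ∀ a → a ℕ.≤ p → (toℕ (rotate k a) ℕ.+ o) % n ≡ a
  unrotate a a≤p = begin
    (toℕ (rotate k a) ℕ.+ o) % n                ≡⟨ cong (λ x → (x ℕ.+ o) % n) (toℕ-rotate k a) ⟩
    ((toℕ k ℕ.+ a) % n ℕ.+ o) % n               ≡⟨ %-distribˡ-+ ((toℕ k ℕ.+ a) % n) o n ⟩
    ((toℕ k ℕ.+ a) % n % n ℕ.+ o % n) % n       ≡⟨ cong (λ x → (x ℕ.+ o % n) % n) (m%n%n≡m%n (toℕ k ℕ.+ a) n) ⟩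
    ((toℕ k ℕ.+ a) % n ℕ.+ o % n) % n           ≡⟨ %-distribˡ-+ (toℕ k ℕ.+ a) o n ⟨
    (toℕ k ℕ.+ a ℕ.+ o) % n                     ≡⟨ cong (_% n) (lemma (toℕ k) a o) ⟩
    (a ℕ.+ (toℕ k ℕ.+ o)) % n                   ≡⟨ cong (λ x → (a ℕ.+ x) % n) (ℕ.m+[n∸m]≡n (ℕ.<⇒≤ (toℕ<n k))) ⟩
    (a ℕ.+ n) % n                               ≡⟨ [m+n]%n≡m%n a n ⟩
    a % n                                       ≡⟨ m<n⇒m%n≡m (s≤s a≤p) ⟩
    a                                           ∎

toℕ-punchIn : ∀ {p} (k : Fin (suc p)) (i : Fin p) →
              (toℕ k ℕ.≤ toℕ i × toℕ (punchIn k i) ≡ suc (toℕ i)) ⊎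
              (toℕ i ℕ.< toℕ k × toℕ (punchIn k i) ≡ toℕ i)
toℕ-punchIn zero    i       = inj₁ (z≤n , refl)
toℕ-punchIn (suc k) zero    = inj₂ (s≤s z≤n , refl)
toℕ-punchIn (suc k) (suc i) with toℕ-punchIn k i
... | inj₁ (k≤i , eq) = inj₁ (s≤s k≤i , cong suc eq)
... | inj₂ (i<k , eq) = inj₂ (s≤s i<k , cong suc eq)

-- The entry with index punchIn k i is the (r + 1)-st one after the k-th in
-- cyclic order, and - k + i = r + t p is its position among the vertices kept.
record Slot {p} (k : Fin (suc p)) (i : Fin p) : Set where
  field
    r        : ℕ
    t        : ℤ
    r<p      : r ℕ.< p
    position : - + toℕ k + + toℕ i ≡ + r + t * + p
    cyclic   : punchIn k i ≡ rotate k (suc r)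
    vertex   : + toℕ k + 1ℤ + + r + t * + suc p ≡ + toℕ (punchIn k i)

-- Entries after the `k`-th lie in block 0 with `r = i - k`; those before it are reached by wrapping
-- round, so they lie in block -1 with `r = i + (p - k)`.
slot : ∀ {p} (k : Fin (suc p)) (i : Fin p) → Slot k i
slot {p} k i with toℕ-punchIn k i
... | inj₁ (k≤i , eq) with r , i≡ ← ℕ.m≤n⇒∃[o]m+o≡n k≤i = record
  { r        = r
  ; t        = 0ℤ
  ; r<p      = ℕ.≤-<-trans (subst (r ℕ.≤_) i≡ (ℕ.m≤n+m r (toℕ k))) (toℕ<n i)
  ; position = trans (cong (λ x → - + toℕ k + + x) (sym i≡)) (lemma (+ toℕ k) (+ r) (+ p))
  ; cyclic   = toℕ-injective (trans (sym (m<n⇒m%n≡m (toℕ<n (punchIn k i))))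
      (trans (cong (_% suc p) index) (sym (toℕ-rotate k (suc r)))))
  ; vertex   = trans (lemma′ (+ toℕ k) (+ r) (+ suc p)) (cong +_ (sym index))
  }
  where
  lemma : ∀ k r p → - k + (k + r) ≡ r + 0ℤ * p
  lemma = solve-∀
  lemma′ : ∀ k r n → k + 1ℤ + r + 0ℤ * n ≡ k + (1ℤ + r)
  lemma′ = solve-∀
  index : toℕ (punchIn k i) ≡ toℕ k ℕ.+ suc r
  index = trans eq (trans (cong suc (sym i≡)) (sym (ℕ.+-suc (toℕ k) r)))
... | inj₂ (i<k , eq) with o , k+o≡p ← ℕ.m≤n⇒∃[o]m+o≡n (toℕ≤pred[n] k) = record
  { r        = toℕ i ℕ.+ o
  ; t        = - 1ℤ
  ; r<p      = subst (toℕ i ℕ.+ o ℕ.<_) k+o≡p (ℕ.+-monoˡ-< o i<k)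
  ; position = trans (lemma (+ toℕ k) (+ toℕ i) (+ o))
      (cong (λ x → + toℕ i + + o + - 1ℤ * + x) k+o≡p)
  ; cyclic   = toℕ-injective (begin
      toℕ (punchIn k i)                      ≡⟨ m<n⇒m%n≡m (toℕ<n (punchIn k i)) ⟨
      toℕ (punchIn k i) % suc p              ≡⟨ cong (_% suc p) eq ⟩
      toℕ i % suc p                          ≡⟨ [m+n]%n≡m%n (toℕ i) (suc p) ⟨
      (toℕ i ℕ.+ suc p) % suc p              ≡⟨ cong (λ x → (toℕ i ℕ.+ suc x) % suc p) k+o≡p ⟨
      (toℕ i ℕ.+ suc (toℕ k ℕ.+ o)) % suc p  ≡⟨ cong (_% suc p) (lemma″ (toℕ i) (toℕ k) o) ⟩
      (toℕ k ℕ.+ suc (toℕ i ℕ.+ o)) % suc p  ≡⟨ toℕ-rotate k (suc (toℕ i ℕ.+ o)) ⟨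
      toℕ (rotate k (suc (toℕ i ℕ.+ o)))     ∎)
  ; vertex   = trans
      (cong (λ x → + toℕ k + 1ℤ + + (toℕ i ℕ.+ o) + - 1ℤ * + suc x) (sym k+o≡p))
      (trans (lemma′ (+ toℕ k) (+ toℕ i) (+ o)) (cong +_ (sym eq)))
  }
  where
  open ≡-Reasoning
  lemma : ∀ k i o → - k + i ≡ i + o + - 1ℤ * (k + o)
  lemma = solve-∀
  lemma′ : ∀ k i o → k + 1ℤ + (i + o) + - 1ℤ * (1ℤ + (k + o)) ≡ i
  lemma′ = solve-∀
  lemma″ : ∀ i k o → i ℕ.+ suc (k ℕ.+ o) ≡ k ℕ.+ suc (i ℕ.+ o)
  lemma″ = ℕ-Solver.solve-∀

next≡rotate : ∀ {p} (k : Fin (suc p)) → next k ≡ rotate k 1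
next≡rotate {p} k = cong (_mod suc p) (ℕ.+-comm 1 (toℕ k))

-- Lets the test `x ≡ j` on indices be replaced by an equivalent one, here a numerical condition on
-- `r`.
decrement-at : ∀ {n} (q : Vector ℤ n) (j x : Fin n) {P : Set} (P? : Dec P) →
               (P → x ≡ j) → (x ≡ j → P) → updateAt q j (_- 1ℤ) x ≡ q x - indicator P?
decrement-at q j x (yes P) to from rewrite to P = updateAt-updates j q
decrement-at q j x (no ¬P) to from =
  trans (updateAt-minimal x j q (¬P ∘ from)) (sym (+-identityʳ (q x)))

-- The entry `r + 1` places after the `k`-th is `next k` exactly when `r = 0`, and `prev k` exactly
-- when `r + 1 = p`.
reduce-entry : ∀ {p} (k : Fin (suc p)) (q : Vector ℤ (suc p)) (i : Fin p) →
               let open Slot (slot k i) in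
               reduce k q i ≡ q (punchIn k i) - indicator (suc r ℕ.≟ p) - indicator (r ℕ.≟ 0)
reduce-entry {suc zero} k q i with slot k i
-- The only other index is both neighbours of `k`, so the 2 subtracted is the sum of both
-- indicators.
... | record { r = zero  ; cyclic = cyclic } = trans
  (cong (λ x → q x - + 2) (trans (next≡rotate k) (sym cyclic)))
  (lemma (q (punchIn k i)))
  where
  lemma : ∀ x → x - + 2 ≡ x - 1ℤ - 1ℤ
  lemma = solve-∀
... | record { r = suc r ; r<p = s≤s () }
reduce-entry {p@(suc (suc _))} k q i = trans
  (decrement-at (updateAt q (prev k) (_- 1ℤ)) (next k) (punchIn k i) (r ℕ.≟ 0)
    (λ r≡0 → trans cyclic (trans (cong (rotate k ∘ suc) r≡0) (sym (next≡rotate k))))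
    (λ eq → ℕ.suc-injective (rotate-injective k r<p (s≤s z≤n)
      (trans (sym cyclic) (trans eq (next≡rotate k))))))
  (cong (_- indicator (r ℕ.≟ 0))
    (decrement-at q (prev k) (punchIn k i) (suc r ℕ.≟ p)
      -- `prev k` unfolds to `rotate k p`.
      (λ 1+r≡p → trans cyclic (cong (rotate k) 1+r≡p))
      (λ eq → rotate-injective k r<p ℕ.≤-refl (trans (sym cyclic) eq))))
  where open Slot (slot k i)

-- Periodicity of the diagonal.

module _ {n F} (per : IsPeriodic n F) where
  open InfiniteFrieze F
  open IsPeriodic per
  open ≡-Reasoning

  diagonal-forward : ∀ i l → m i i ≡ m (i + + l * + n) (i + + l * + n)
  diagonal-forward i zero    = cong (λ x → m x x) (lemma i (+ n))
    where
    lemma : ∀ i n → i ≡ i + 0ℤ * n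
    lemma = solve-∀
  diagonal-forward i (suc l) = begin
    m i i                                    ≡⟨ diagonal-forward i l ⟩
    m j j                                    ≡⟨ periodic j j ≤-refl ⟩
    m (j + + n) (j + + n)                    ≡⟨ cong (λ x → m x x) (lemma i (+ l) (+ n)) ⟩
    m (i + + suc l * + n) (i + + suc l * + n)  ∎
    where
    j = i + + l * + n
    lemma : ∀ i l n → i + l * n + n ≡ i + (1ℤ + l) * n
    lemma = solve-∀

  -- A negative shift is handled by going forward from the shifted index back to `i`.
  diagonal-periodic : ∀ i t → m (i + t * + n) (i + t * + n) ≡ m i i
  diagonal-periodic i (+ l)      = sym (diagonal-forward i l)
  diagonal-periodic i (-[1+ l ]) = trans (diagonal-forward (i + -[1+ l ] * + n) (suc l))
    (cong (λ x → m x x) (lemma i (+ suc l) (+ n)))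
    where
    lemma : ∀ i l n → i + - l * n + l * n ≡ i
    lemma = solve-∀

-- The reduced frieze.

proposition2p9 : ∀ (p : ℕ) (F : InfiniteFrieze) (q : Vector ℤ (suc p)) →
    IsPeriodic (suc p) F → IsQuiddity F q →
    ∀ (k : Fin (suc p)) → q k ≡ 1ℤ →
    ∃[ F′ ] (IsPeriodic p F′ × IsQuiddity F′ (reduce k q))
proposition2p9 p F q per (s , q≡) k qk≡1 = construct p q per q≡ k qk≡1
  where
  open InfiniteFrieze F
  A : ArcFrieze
  A = toArcs F
  open ArcFrieze A using (d)
  open Ears A

  diagonal : ∀ y → d (y - 1ℤ) (y + 1ℤ) ≡ m y y
  diagonal y = cong₂ m (i-1+1≡i y) (i+1-1≡i y)

  ear : ∀ x y → x + 1ℤ ≡ y → m y y ≡ 1ℤ → Ear x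
  ear x y refl eq = trans (cong (m y) (i+1-1≡i y)) eq

  construct : ∀ p (q : Vector ℤ (suc p)) → IsPeriodic (suc p) F →
              (∀ i → q i ≡ m (s + + toℕ i) (s + + toℕ i)) →
              ∀ k → q k ≡ 1ℤ → ∃[ F′ ] (IsPeriodic p F′ × IsQuiddity F′ (reduce k q))
  -- With period 1 every vertex would be cut off by an ear.
  construct zero q per q≡ zero q0≡1 = ⊥-elim (no-consecutive-ears {s} (ears s) (ears (s + 1ℤ)))
    where
    lemma : ∀ s x → x + 1ℤ ≡ s + 0ℤ + (x + 1ℤ - s) * 1ℤ
    lemma = solve-∀
    ears : ∀ x → Ear x
    ears x = ear x _ (lemma s x)
      (trans (diagonal-periodic per (s + 0ℤ) (x + 1ℤ - s)) (trans (sym (q≡ zero)) q0≡1))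
  construct p@(suc _) q per q≡ k qk≡1 =
    -- Since `ψ 0ℤ` is the vertex right after the `k`-th, the reduced tuple is read off from index
    -- `- + toℕ k`.
    fromArcs restrict , record { nonZero = _ ; periodic = periodic′ } , - + toℕ k , quiddity
    where
    open ≡-Reasoning
    c : ℤ
    c = s + + toℕ k

    ears : ∀ x t → x + 1ℤ ≡ c + t * + suc p → Ear x
    ears x t x+1≡ = ear x _ x+1≡ (trans (diagonal-periodic per c t) (trans (sym (q≡ k)) qk≡1))

    open Skip c p
    open Cut A ears

    periodic′ : ∀ i j → i ≤ j → d (ψ (i - 1ℤ)) (ψ (j + 1ℤ)) ≡
                                d (ψ (i + + p - 1ℤ)) (ψ (j + + p + 1ℤ))
    periodic′ i j i≤j = begin
      m (ψ (i - 1ℤ) + 1ℤ) (ψ (j + 1ℤ) - 1ℤ)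
        ≡⟨ IsPeriodic.periodic per _ _ bound ⟩
      m (ψ (i - 1ℤ) + 1ℤ + + suc p) (ψ (j + 1ℤ) - 1ℤ + + suc p)
        ≡⟨ cong₂ m (swap (ψ (i - 1ℤ)) 1ℤ (+ suc p)) (swap (ψ (j + 1ℤ)) (- 1ℤ) (+ suc p)) ⟩
      d (ψ (i - 1ℤ) + + suc p) (ψ (j + 1ℤ) + + suc p)
        ≡⟨ cong₂ d (ψ-periodic (i - 1ℤ)) (ψ-periodic (j + 1ℤ)) ⟨
      d (ψ (i - 1ℤ + + p)) (ψ (j + 1ℤ + + p))
        ≡⟨ cong₂ (λ x y → d (ψ x) (ψ y)) (swap i (- 1ℤ) (+ p)) (swap j 1ℤ (+ p)) ⟩
      d (ψ (i + + p - 1ℤ)) (ψ (j + + p + 1ℤ)) ∎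
      where
      swap : ∀ a b c → a + b + c ≡ a + c + b
      swap = solve-∀
      -- The kept vertex `ψ j` lies strictly between the two ends.
      bound : ψ (i - 1ℤ) + 1ℤ ≤ ψ (j + 1ℤ) - 1ℤ
      bound = ≤-trans (edge-< (step (i - 1ℤ))) (≤-trans
        (ψ-mono (≤-trans (≤-reflexive (i-1+1≡i i)) i≤j))
        (≤-trans (≤-reflexive (sym (i+1-1≡i (ψ j)))) (+-monoˡ-≤ (- 1ℤ) (edge-< (step j)))))

    quiddity : ∀ i → reduce k q i ≡
               d (ψ (- + toℕ k + + toℕ i - 1ℤ)) (ψ (- + toℕ k + + toℕ i + 1ℤ))
    quiddity i = begin
      reduce k q i
        ≡⟨ reduce-entry k q i ⟩
      q (punchIn k i) - indicator (suc r ℕ.≟ p) - indicator (r ℕ.≟ 0)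
        ≡⟨ cong (λ y → y - indicator (suc r ℕ.≟ p) - indicator (r ℕ.≟ 0)) entry ⟩
      d (ψ x - 1ℤ) (ψ x + 1ℤ) - indicator (suc r ℕ.≟ p) - indicator (r ℕ.≟ 0)
        ≡⟨ quiddity-shift t r<p position ⟨
      d (ψ (x - 1ℤ)) (ψ (x + 1ℤ)) ∎
      where
      open Slot (slot k i)
      x : ℤ
      x = - + toℕ k + + toℕ i
      regroup : ∀ s k r t → s + k + 1ℤ + r + t ≡ s + (k + 1ℤ + r + t)
      regroup = solve-∀
      ψx≡ : ψ x ≡ s + + toℕ (punchIn k i)
      ψx≡ = trans (ψ-value t r<p position)
        (trans (regroup s (+ toℕ k) (+ r) (t * + suc p)) (cong (λ y → s + y) vertex))
      entry : q (punchIn k i) ≡ d (ψ x - 1ℤ) (ψ x + 1ℤ)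
      entry = trans (q≡ (punchIn k i)) (trans (cong (λ y → m y y) (sym ψx≡)) (sym (diagonal (ψ x))))
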